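{- Let $\kappa>0$ and $\ell:=2\lceil\log_2\kappa\rceil+1$. For $i\in[\ell]$ let $\mathcal{S}_i\subset\mathbb{N}^n$ be a finite downward-closed set (if $e\in\mathcal{S}_i$ and $e'\le e$ coordinatewise then $e'\in\mathcal{S}_i$) with $\mathcal{S}_i^*:=\mathcal{S}_i\setminus\{0\}\ne\emptyset$, let $T_i\in(\mathcal{S}_i\times\mathcal{S}_i\to\mathbb{F})$ be the matrix with $(v,u)$-th entry $\binom{v}{u}=\prod_j\binom{v_j}{u_j}$, and let $T'_i:=(T_i^{ -1})_{\mathcal{S}_i^*,\mathcal{S}_i}$ (the rows indexed by $\mathcal{S}_i^*$ of $T_i^{ -1}$). Let $T':=\otimes_{i\in[\ell]}T'_i$, with rows indexed by $\mathcal{S}':=\times_i\mathcal{S}_i^*$ and columns indexed by $\mathcal{S}:=\times_i\mathcal{S}_i$. Let $\mathcal{M}\subseteq\mathcal{S}$ be any set of $\kappa$ columns ("marked"). Then there exists a set $\mathcal{C}\subseteq\mathcal{S}\setminus\mathcal{M}$ with $|\mathcal{C}|=|\mathcal{S}'|$ such that $\det\big(T'_{\mathcal{S}',\mathcal{C}}\big)\ne0$.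
   Context: $\mathbb{F}$ is a field; $\binom{a}{b}=0$ for $a<b$ and $\binom{a}{0}=1$. $M_{\mathcal{I},\mathcal{J}}$ denotes the submatrix of $M$ with rows $\mathcal{I}$ and columns $\mathcal{J}$, and $\otimes$ is the Kronecker (tensor) product of matrices, with rows and columns indexed by tuples. -}

module Defs where

open import Level using (Level; _⊔_) renaming (suc to lsuc)
open import Algebra.Bundles using (CommutativeRing)
open import Data.Nat as ℕ using (ℕ; zero; suc)
open import Data.Nat.Combinatorics using (_C_)
open import Data.Fin using (Fin; zero; suc)
open import Data.Vec using (Vec; []; _∷_; lookup; replicate; zipWith)
import Data.Vec as Vec
import Data.Vec.Properties
import Data.Nat.Logarithm
import Relation.Nullary
open import Data.List using (List; []; _∷_; map; concatMap; filter; length)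
open import Data.Product using (Σ; _×_; _,_; ∃)
open import Relation.Nullary using (¬_)
open import Relation.Binary.PropositionalEquality using (_≡_; _≢_)
open import Data.Vec.Relation.Binary.Pointwise.Inductive using (Pointwise)
open import Data.List.Membership.Propositional using (_∈_)

record Field (c ℓ : Level) : Set (lsuc (c ⊔ ℓ)) where
  field
    commutativeRing : CommutativeRing c ℓ
  open CommutativeRing commutativeRing public
  field
    1≉0     : ¬ (1# ≈ 0#)
    inverse : ∀ x → ¬ (x ≈ 0#) → Σ Carrier λ y → (x * y) ≈ 1#

binomVec : ∀ {n} → Vec ℕ n → Vec ℕ n → ℕ
binomVec v u = Vec.foldr _ ℕ._*_ 1 (zipWith _C_ v u)

DownClosed : ∀ {n} → List (Vec ℕ n) → Set
DownClosed {n} S = ∀ e → e ∈ S → ∀ e' → Pointwise ℕ._≤_ e' e → e' ∈ S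

prodList : ∀ {A : Set} ℓ → (Fin ℓ → List A) → List (Vec A ℓ)
prodList zero    L = [] ∷ []
prodList (suc ℓ) L =
  concatMap (λ a → map (a ∷_) (prodList ℓ (λ i → L (suc i)))) (L zero)

module _ {c ℓ} (F : Field c ℓ) where
  open Field F using (Carrier; _≈_; _+_; _*_; -_; 0#; 1#)

  ℕ→F : ℕ → Carrier
  ℕ→F zero    = 0#
  ℕ→F (suc m) = 1# + ℕ→F m

  ΣL : ∀ {I : Set} → List I → (I → Carrier) → Carrier
  ΣL []       f = 0#
  ΣL (x ∷ xs) f = f x + ΣL xs f

  ΠFin : ∀ k → (Fin k → Carrier) → Carrier
  ΠFin zero    f = 1#
  ΠFin (suc k) f = f zero * ΠFin k (λ i → f (suc i))

  Tmat : ∀ {n} → Vec ℕ n → Vec ℕ n → Carrier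
  Tmat v u = ℕ→F (binomVec v u)

  kron : ∀ {I : Set} ℓ' → (Fin ℓ' → I → I → Carrier) → Vec I ℓ' → Vec I ℓ' → Carrier
  kron ℓ' A v u = ΠFin ℓ' (λ i → A i (lookup v i) (lookup u i))

  -- Determinant of the submatrix with rows `rs` and columns `cs` (in the
  -- listed orders), by Laplace expansion along the first row; 0 if the
  -- lists have different lengths (never used in that case).
  private
    expand : ∀ {I : Set} → (List I → Carrier) → (I → Carrier) → Carrier →
             List I → List I → Carrier
    expand d row s pre []       = 0#
    expand d row s pre (c ∷ cs) =
      (s * (row c * d (pre Data.List.++ cs))) + expand d row (- s) (pre Data.List.++ (c ∷ [])) cs

  det : ∀ {I : Set} → (I → I → Carrier) → List I → List I → Carrier
  det M []       []       = 1#
  det M []       (_ ∷ _)  = 0#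
  det M (r ∷ rs) cs       = expand (det M rs) (M r) 1# [] cs

  δ : ∀ {n} → Vec ℕ n → Vec ℕ n → Carrier
  δ v w with Data.Vec.Properties.≡-dec ℕ._≟_ v w
  ... | Relation.Nullary.yes _ = 1#
  ... | Relation.Nullary.no  _ = 0#

star : ∀ {n} → List (Vec ℕ n) → List (Vec ℕ n)
star {n} S = filter (λ e → Relation.Nullary.¬? (Data.Vec.Properties.≡-dec ℕ._≟_ e (replicate n 0))) S

ellOf : ℕ → ℕ
ellOf κ = 2 ℕ.* Data.Nat.Logarithm.⌈log₂ κ ⌉ ℕ.+ 1

InProd : ∀ {n ℓ'} → (Fin ℓ' → List (Vec ℕ n)) → Vec (Vec ℕ n) ℓ' → Set
InProd S t = ∀ i → lookup t i ∈ S i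

{-# OPTIONS --safe #-}
module Submission where

-- Column 0 of T_i consists of ones and T_i⁻¹ T_i = I, so every row of T'_i sums to zero, and any
-- single column of T'_i is a combination of the others. If fewer than 2^ℓ columns are marked, at
-- most one slice by the first coordinate contains 2^(ℓ-1) or more marks. Leave out that value u₀
-- of the first coordinate and recurse into every other slice. The chosen columns also span those
-- with first coordinate u₀, hence all columns of T', hence, as T_i provides a right inverse of
-- T'_i, all unit vectors. If their determinant were zero, expanding the unit vectors by
-- multilinearity would give det I = 0. The columns are chosen from the marks alone, without a
-- rank computation, which would require deciding equality in the field.

open import Defs
import Algebra.Properties.CommutativeSemigroup
import Algebra.Properties.Ring
import Algebra.Solver.Ring.NaturalCoefficients.Default
open import Data.Empty using (⊥-elim)
open import Data.Fin using (Fin; zero; suc)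
open import Data.List using (List; []; _∷_; _++_; map; length; concatMap; cartesianProductWith; filter)
open import Data.List.Membership.Propositional using (_∈_; _∉_; find)
open import Data.List.Membership.Propositional.Properties using (∈-∃++; ∈-map⁺; ∈-map⁻; ∈-cartesianProductWith⁻; ∈-filter⁻)
import Data.List.Membership.DecPropositional as DecMembership
open import Data.List.Properties using (++-assoc; ++-identityʳ; map-++; length-map; length-++; length-++-comm; filter-accept; filter-reject; filter-all)
open import Data.List.Relation.Binary.Permutation.Propositional using (_↭_; refl; prep; swap; trans; ↭-sym; ↭-refl; ↭⇒↭ₛ)
open import Data.List.Relation.Binary.Permutation.Propositional.Properties using (shift; ∈-resp-↭; ↭-length; map⁺)
import Data.List.Relation.Binary.Permutation.Setoid.Properties as Permₛ
open import Data.List.Relation.Binary.Subset.Propositional using (_⊆_)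
open import Data.List.Relation.Binary.Subset.Propositional.Properties using (xs⊆xs++ys; xs⊆ys++xs)
open import Data.List.Relation.Unary.All as All using (All; []; _∷_)
import Data.List.Relation.Unary.All.Properties as Allₚ
open import Data.List.Relation.Unary.AllPairs using ([]; _∷_)
open import Data.List.Relation.Unary.Any using (here; there; any?)
open import Data.List.Relation.Unary.Unique.Propositional using (Unique)
import Data.List.Relation.Unary.Unique.Propositional.Properties as Uniqueₚ
open import Data.Nat as ℕ using (ℕ; zero; suc; _≤_; _<_; s≤s; z≤n; ⌈_/2⌉)
open import Data.Nat.Combinatorics using (nCk≡nC[n∸k]; nCn≡1)
open import Data.Nat.Induction using (<-wellFounded)
open import Data.Nat.Logarithm using (⌈log₂_⌉)
open import Data.Nat.Logarithm.Core using (⌈log2⌉)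
import Data.Nat.Properties as ℕₚ
open import Data.Product using (_,_; proj₁; _×_; ∃; ∃₂)
open import Data.Vec using (Vec; []; _∷_; head; tail; lookup; replicate)
open import Data.Vec.Properties using (∷-injective; ∷-injectiveʳ; ≡-dec)
open import Data.Vec.Relation.Binary.Pointwise.Inductive using (Pointwise; []; _∷_)
open import Induction.WellFounded using (Acc; acc)
open import Level using (_⊔_)
open import Relation.Binary.Definitions using (DecidableEquality)
open import Relation.Binary.PropositionalEquality as ≡ using (_≡_; _≢_)
import Relation.Binary.Reasoning.Setoid
open import Relation.Nullary using (¬_; yes; no; Dec; ¬?)

-- Lists up to permutation.

∈⇒↭∷ : ∀ {a} {A : Set a} {x : A} {xs} → x ∈ xs → ∃ λ ys → xs ↭ x ∷ ys
∈⇒↭∷ x∈xs with ∈-∃++ x∈xs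
... | ys , zs , ≡.refl = ys ++ zs , shift _ ys zs

⊆-tail : ∀ {a} {A : Set a} {x : A} {xs ys} → xs ⊆ x ∷ ys → x ∉ xs → xs ⊆ ys
⊆-tail xs⊆ x∉xs z∈xs with xs⊆ z∈xs
... | here ≡.refl = ⊥-elim (x∉xs z∈xs)
... | there z∈ys  = z∈ys

Unique-resp-↭ : ∀ {A : Set} {xs ys : List A} → xs ↭ ys → Unique xs → Unique ys
Unique-resp-↭ {A} p = Permₛ.Unique-resp-↭ (≡.setoid A) (↭⇒↭ₛ p)

-- By `excl`, distinct elements cannot both satisfy `P`: the one that does, if any, is set aside,
-- and otherwise the head. The element removed later is the first coordinate whose slice may carry
-- too many marks.
setAside : ∀ {A : Set} {P : A → Set} → (∀ x → Dec (P x)) → ∀ {xs} → Unique xs → 0 < length xs →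
  (∀ {x y} → x ≢ y → P x → ¬ P y) → ∃₂ λ x ys → xs ↭ x ∷ ys × All (λ y → ¬ P y) ys
setAside P? {xs} uniq 0<xs excl with any? P? xs
setAside P? {x ∷ xs} uniq 0<xs excl | no ¬p = x , xs , ↭-refl , All.tail (Allₚ.¬Any⇒All¬ _ ¬p)
setAside P? {xs} uniq 0<xs excl | yes p with find p
... | x , x∈xs , px with ∈⇒↭∷ x∈xs
... | ys , xs↭x∷ys with Unique-resp-↭ xs↭x∷ys uniq
... | x≢ys ∷ _ = x , ys , xs↭x∷ys , All.map (λ x≢y → excl x≢y px) x≢ys

-- Cartesian products of lists.

prodList-suc : ∀ {A : Set} k (L : Fin (suc k) → List A) →
  prodList (suc k) L ≡ cartesianProductWith _∷_ (L zero) (prodList k (λ i → L (suc i)))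
prodList-suc k L = go (L zero)
  where
  go : ∀ xs → concatMap (λ a → map (a ∷_) (prodList k (λ i → L (suc i)))) xs
            ≡ cartesianProductWith _∷_ xs (prodList k (λ i → L (suc i)))
  go []       = ≡.refl
  go (x ∷ xs) = ≡.cong (_ ++_) (go xs)

length-cartesianProductWith : ∀ {A B C : Set} (f : A → B → C) xs ys →
  length (cartesianProductWith f xs ys) ≡ length xs ℕ.* length ys
length-cartesianProductWith f []       ys = ≡.refl
length-cartesianProductWith f (x ∷ xs) ys =
  ≡.trans (length-++ (map (f x) ys)) (≡.cong₂ ℕ._+_ (length-map (f x) ys) (length-cartesianProductWith f xs ys))

length-prodList : ∀ {A : Set} k (L : Fin (suc k) → List A) →
  length (prodList (suc k) L) ≡ length (L zero) ℕ.* length (prodList k (λ i → L (suc i)))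
length-prodList k L = ≡.trans (≡.cong length (prodList-suc k L)) (length-cartesianProductWith _∷_ (L zero) _)

prodList-unique : ∀ {A : Set} k (L : Fin k → List A) → (∀ i → Unique (L i)) → Unique (prodList k L)
prodList-unique zero    L uniq = [] ∷ []
prodList-unique (suc k) L uniq = ≡.subst Unique (≡.sym (prodList-suc k L))
  (Uniqueₚ.cartesianProductWith⁺ _∷_ ∷-injective (uniq zero) (prodList-unique k (λ i → L (suc i)) (λ i → uniq (suc i))))

InProduct : ∀ {A : Set} {k} → (Fin k → List A) → Vec A k → Set
InProduct L t = ∀ i → lookup t i ∈ L i

∈-prodList⁻ : ∀ {A : Set} k (L : Fin k → List A) {t} → t ∈ prodList k L → InProduct L t
∈-prodList⁻ (suc k) L t∈ i
  with ∈-cartesianProductWith⁻ _∷_ (L zero) _ (≡.subst (_ ∈_) (prodList-suc k L) t∈)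
∈-prodList⁻ (suc k) L t∈ zero    | a , w , a∈ , w∈ , ≡.refl = a∈
∈-prodList⁻ (suc k) L t∈ (suc i) | a , w , a∈ , w∈ , ≡.refl = ∈-prodList⁻ k (λ i → L (suc i)) w∈ i

-- Slices of the marked set by the first coordinate.

module _ {X : Set} (_≟_ : DecidableEquality X) where

  slice : ∀ {k} → X → List (Vec X (suc k)) → List (Vec X k)
  slice u [] = []
  slice u ((x ∷ w) ∷ M) with u ≟ x
  ... | yes _ = w ∷ slice u M
  ... | no  _ = slice u M

  ∈-slice⁺ : ∀ {k u} {w : Vec X k} {M} → (u ∷ w) ∈ M → w ∈ slice u M
  ∈-slice⁺ {u = u} {M = (x ∷ _) ∷ M} uw∈ with u ≟ x | uw∈
  ... | yes _   | here ≡.refl = here ≡.refl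
  ... | yes _   | there p     = there (∈-slice⁺ p)
  ... | no u≢x  | here ≡.refl = ⊥-elim (u≢x ≡.refl)
  ... | no _    | there p     = ∈-slice⁺ p

  -- A vector has only one head, so each entry of `M` is counted in at most one of the two slices.
  length-slices : ∀ {k u v} (M : List (Vec X (suc k))) → u ≢ v →
    length (slice u M) ℕ.+ length (slice v M) ≤ length M
  length-slices [] u≢v = z≤n
  length-slices {u = u} {v} ((x ∷ w) ∷ M) u≢v with u ≟ x | v ≟ x
  ... | yes ≡.refl | yes ≡.refl = ⊥-elim (u≢v ≡.refl)
  ... | yes _      | no _       = s≤s (length-slices M u≢v)
  ... | no _       | yes _      = ℕₚ.≤-trans (ℕₚ.≤-reflexive (ℕₚ.+-suc _ _)) (s≤s (length-slices M u≢v))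
  ... | no _       | no _       = ℕₚ.m≤n⇒m≤1+n (length-slices M u≢v)

  slices-not-both-large : ∀ {k u v} (M : List (Vec X (suc k))) {m} → length M < 2 ℕ.* m → u ≢ v →
    m ≤ length (slice u M) → ¬ (m ≤ length (slice v M))
  slices-not-both-large M {m} M< u≢v m≤u m≤v = ℕₚ.<⇒≱ M< (ℕₚ.≤-trans
    (ℕₚ.+-mono-≤ m≤u (ℕₚ.≤-trans (ℕₚ.≤-reflexive (ℕₚ.+-identityʳ m)) m≤v)) (length-slices M u≢v))

-- Binomials at zero, the size of a punctured set, and the bound on the number of marks.

binomVec-zero : ∀ {n} (v : Vec ℕ n) → binomVec v (replicate n 0) ≡ 1
binomVec-zero []      = ≡.refl
-- The first factor is 1 by the symmetry of binomial coefficients: choosing 0 out of `m` is choosing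
-- `m` out of `m`.
binomVec-zero (m ∷ v) = ≡.cong₂ ℕ._*_ (≡.trans (nCk≡nC[n∸k] {0} {m} z≤n) (nCn≡1 m)) (binomVec-zero v)

0≤ : ∀ {n} (v : Vec ℕ n) → Pointwise _≤_ (replicate n 0) v
0≤ []      = []
0≤ (_ ∷ v) = z≤n ∷ 0≤ v

-- Uniqueness means that the filter drops a single entry. With `z` = 0 this is why leaving out one
-- slice leaves exactly as many slices as there are rows.
length-filter-≢ : ∀ {A : Set} (_≟_ : DecidableEquality A) {z : A} {xs} → Unique xs → z ∈ xs →
  suc (length (filter (λ x → ¬? (x ≟ z)) xs)) ≡ length xs
length-filter-≢ _≟_ {z} {x ∷ xs} (x≢ ∷ uniq) (here ≡.refl) = ≡.cong (λ ys → suc (length ys))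
  (≡.trans (filter-reject (λ x → ¬? (x ≟ z)) (λ z≢z → z≢z ≡.refl))
    (filter-all (λ x → ¬? (x ≟ z)) (All.map (λ z≢x x≡z → z≢x (≡.sym x≡z)) x≢)))
length-filter-≢ _≟_ {z} {x ∷ xs} (x≢ ∷ uniq) (there z∈xs) = ≡.cong suc
  (≡.trans (≡.cong length (filter-accept (λ x → ¬? (x ≟ z)) (All.lookup x≢ z∈xs)))
    (length-filter-≢ _≟_ uniq z∈xs))

n≤2^⌈log₂n⌉ : ∀ n → n ≤ 2 ℕ.^ ⌈log₂ n ⌉
n≤2^⌈log₂n⌉ n = go n (<-wellFounded n)
  where
  n≤⌈n/2⌉+⌈n/2⌉ : ∀ n → n ≤ ⌈ n /2⌉ ℕ.+ ⌈ n /2⌉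
  n≤⌈n/2⌉+⌈n/2⌉ n = ≡.subst (_≤ ⌈ n /2⌉ ℕ.+ ⌈ n /2⌉) (ℕₚ.⌊n/2⌋+⌈n/2⌉≡n n) (ℕₚ.+-monoˡ-≤ ⌈ n /2⌉ (ℕₚ.⌊n/2⌋≤⌈n/2⌉ n))
  -- The recursion runs on the same accessibility proof as `⌈log2⌉`, so that the logarithm unfolds
  -- along with it.
  go : ∀ n (a : Acc _<_ n) → n ≤ 2 ℕ.^ ⌈log2⌉ n a
  go 0 _ = z≤n
  go 1 _ = s≤s z≤n
  go (suc (suc n)) (acc rs) = ℕₚ.≤-trans (n≤⌈n/2⌉+⌈n/2⌉ (suc (suc n)))
    (ℕₚ.≤-trans (ℕₚ.≤-reflexive (≡.cong (suc ⌈ n /2⌉ ℕ.+_) (≡.sym (ℕₚ.+-identityʳ (suc ⌈ n /2⌉)))))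
      (ℕₚ.*-monoʳ-≤ 2 (go (suc ⌈ n /2⌉) (rs (ℕₚ.⌈n/2⌉<n n)))))

-- With L = `⌈log₂ κ ⌉`, κ ≤ 2^L < 2^(2L+1); the final +1 keeps the inequality strict when L = 0.
κ<2^ellOf : ∀ κ → κ < 2 ℕ.^ ellOf κ
κ<2^ellOf κ = ℕₚ.≤-<-trans (n≤2^⌈log₂n⌉ κ) (ℕₚ.^-monoʳ-< 2 (s≤s (s≤s z≤n))
  (ℕₚ.≤-trans (s≤s (ℕₚ.m≤m+n ⌈log₂ κ ⌉ _)) (ℕₚ.≤-reflexive (ℕₚ.+-comm 1 _))))

-- Determinants as multilinear alternating functions of lists of columns.

module _ {c ℓ} (F : Field c ℓ) where
  open Field F hiding (zero) renaming (refl to ≈-refl; trans to ≈-trans; sym to ≈-sym)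
  open Algebra.Properties.Ring ring using (-1*x≈-x; -‿involutive; +-inverseˡ-unique)
  open Algebra.Properties.CommutativeSemigroup *-commutativeSemigroup using (x∙yz≈y∙xz)
  open Algebra.Solver.Ring.NaturalCoefficients.Default commutativeSemiring
    using (solve; _:=_; _:+_; _:*_)
  open Relation.Binary.Reasoning.Setoid setoid

  α0+β0≈0 : ∀ α β → α * 0# + β * 0# ≈ 0#
  α0+β0≈0 α β = ≈-trans (+-cong (zeroʳ α) (zeroʳ β)) (+-identityʳ 0#)

  x+0y≈x : ∀ x y → x + 0# * y ≈ x
  x+0y≈x x y = ≈-trans (+-congˡ (zeroˡ y)) (+-identityʳ x)

  -- The solver works over commutative semirings, so signs are written as factors of this atom.
  -1# : Carrier
  -1# = - 1#

  -1*-1≈1 : -1# * -1# ≈ 1#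
  -1*-1≈1 = ≈-trans (-1*x≈-x -1#) (-‿involutive 1#)

  combination-interchange : ∀ x y α β a b a′ b′ →
    x * (α * a + β * b) + y * (α * a′ + β * b′) ≈ α * (x * a + y * a′) + β * (x * b + y * b′)
  combination-interchange = solve 8 (λ x y α β a b a′ b′ →
    (x :* (α :* a :+ β :* b) :+ y :* (α :* a′ :+ β :* b′)) :=
    (α :* (x :* a :+ y :* a′) :+ β :* (x :* b :+ y :* b′))) ≈-refl

  module _ {R : Set} where

    Column : Set c
    Column = R → Carrier

    -- The columns already passed over are absorbed into d.
    alternatingSum : (List Column → Carrier) → R → List Column → Carrier
    alternatingSum d r []       = 0#
    alternatingSum d r (x ∷ xs) = x r * d xs + -1# * alternatingSum (λ ys → d (x ∷ ys)) r xs

    -- The arguments are the columns themselves and not their indices, so that a column can be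
    -- replaced by an arbitrary vector, such as a unit vector.
    columnDet : List R → List Column → Carrier
    columnDet []       []      = 1#
    columnDet []       (_ ∷ _) = 0#
    columnDet (r ∷ rs) xs      = alternatingSum (columnDet rs) r xs

    -- The relation between the columns is demanded on the rows `rs` only. This also lets columns be
    -- replaced by pointwise equal ones without function extensionality.
    Linear : List R → (List Column → Carrier) → Set (c ⊔ ℓ)
    Linear rs d = ∀ xs {ys x a b} α β → All (λ r → x r ≈ α * a r + β * b r) rs →
      d (xs ++ x ∷ ys) ≈ α * d (xs ++ a ∷ ys) + β * d (xs ++ b ∷ ys)

    -- Both are proved from the expansion, since in characteristic 2 antisymmetry does not imply the
    -- alternating property.
    Antisymmetric Alternating : (List Column → Carrier) → Set (c ⊔ ℓ)
    Antisymmetric d = ∀ xs {a b ys} → d (xs ++ a ∷ b ∷ ys) ≈ -1# * d (xs ++ b ∷ a ∷ ys)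
    Alternating d = ∀ xs {a ys} → d (xs ++ a ∷ a ∷ ys) ≈ 0#

    -- Once the expansion has passed over a column that is a combination, it is the functional `d`
    -- that becomes a combination.
    alternatingSum-combination : ∀ {d e f} α β → (∀ xs → d xs ≈ α * e xs + β * f xs) → ∀ r xs →
      alternatingSum d r xs ≈ α * alternatingSum e r xs + β * alternatingSum f r xs
    alternatingSum-combination α β eq r [] = ≈-sym (α0+β0≈0 α β)
    alternatingSum-combination {d} {e} {f} α β eq r (x ∷ xs) = begin
      x r * d xs + -1# * alternatingSum (λ ys → d (x ∷ ys)) r xs
        ≈⟨ +-cong (*-congˡ (eq xs)) (*-congˡ (alternatingSum-combination α β (λ ys → eq (x ∷ ys)) r xs)) ⟩
      x r * (α * e xs + β * f xs) + -1# * (α * alternatingSum (λ ys → e (x ∷ ys)) r xs + β * alternatingSum (λ ys → f (x ∷ ys)) r xs)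
        ≈⟨ combination-interchange (x r) -1# α β (e xs) (f xs) _ _ ⟩
      _ ∎

    alternatingSum-scale : ∀ {d e} α → (∀ xs → d xs ≈ α * e xs) → ∀ r xs →
      alternatingSum d r xs ≈ α * alternatingSum e r xs
    alternatingSum-scale {d} {e} α eq r xs =
      ≈-trans (alternatingSum-combination {f = e} α 0# (λ ys → ≈-trans (eq ys) (≈-sym (x+0y≈x _ _))) r xs) (x+0y≈x _ _)

    alternatingSum-zero : ∀ {d} → (∀ xs → d xs ≈ 0#) → ∀ r xs → alternatingSum d r xs ≈ 0#
    alternatingSum-zero {d} eq r xs =
      ≈-trans (alternatingSum-scale {e = d} 0# (λ ys → ≈-trans (eq ys) (≈-sym (zeroˡ _))) r xs) (zeroˡ _)

    alternatingSum-linear : ∀ {r rs d} → Linear rs d → Linear (r ∷ rs) (alternatingSum d r)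
    alternatingSum-linear {r} {d = d} lin [] {ys} {x} {a} {b} α β (xr ∷ xrs) = begin
      x r * d ys + -1# * alternatingSum (λ zs → d (x ∷ zs)) r ys
        ≈⟨ +-cong (*-congʳ xr) (*-congˡ (alternatingSum-combination α β (λ zs → lin [] α β xrs) r ys)) ⟩
      (α * a r + β * b r) * d ys + -1# * (α * alternatingSum (λ zs → d (a ∷ zs)) r ys + β * alternatingSum (λ zs → d (b ∷ zs)) r ys)
        ≈⟨ solve 8 (λ m a α β b d d₁ d₂ →
             ((α :* a :+ β :* b) :* d :+ m :* (α :* d₁ :+ β :* d₂)) :=
             (α :* (a :* d :+ m :* d₁) :+ β :* (b :* d :+ m :* d₂))) ≈-refl -1# (a r) α β (b r) (d ys) _ _ ⟩
      _ ∎
    alternatingSum-linear {r} {d = d} lin (w ∷ xs) {ys} {x} {a} {b} α β eqs@(_ ∷ xrs) = begin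
      w r * d (xs ++ x ∷ ys) + -1# * alternatingSum (λ zs → d (w ∷ zs)) r (xs ++ x ∷ ys)
        ≈⟨ +-cong (*-congˡ (lin xs α β xrs)) (*-congˡ (alternatingSum-linear {d = λ zs → d (w ∷ zs)} (λ zs → lin (w ∷ zs)) xs α β eqs)) ⟩
      w r * (α * d (xs ++ a ∷ ys) + β * d (xs ++ b ∷ ys)) + -1# *
        (α * alternatingSum (λ zs → d (w ∷ zs)) r (xs ++ a ∷ ys) + β * alternatingSum (λ zs → d (w ∷ zs)) r (xs ++ b ∷ ys))
        ≈⟨ combination-interchange (w r) -1# α β (d (xs ++ a ∷ ys)) _ _ _ ⟩
      _ ∎

    alternatingSum-antisymmetric : ∀ {r d} → Antisymmetric d → Antisymmetric (alternatingSum d r)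
    alternatingSum-antisymmetric {r} {d} anti [] {a} {b} {ys} = begin
      a r * d (b ∷ ys) + -1# * (b r * d (a ∷ ys) + -1# * alternatingSum (λ zs → d (a ∷ b ∷ zs)) r ys)
        -- The terms that delete `a` and `b` trade places and the rest changes sign by `anti`; the
        -- factor (-1)² is inserted by hand because the solver cannot know that it is 1.
        ≈⟨ +-cong (≈-sym (≈-trans (*-congʳ -1*-1≈1) (*-identityˡ _)))
             (*-congˡ (+-congˡ (*-congˡ (alternatingSum-scale -1# (λ zs → anti []) r ys)))) ⟩
      (-1# * -1#) * (a r * d (b ∷ ys)) + -1# * (b r * d (a ∷ ys) + -1# * (-1# * alternatingSum (λ zs → d (b ∷ a ∷ zs)) r ys))
        ≈⟨ solve 4 (λ m x y z → ((m :* m) :* x :+ m :* (y :+ m :* (m :* z))) := (m :* (y :+ m :* (x :+ m :* z))))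
             ≈-refl -1# (a r * d (b ∷ ys)) (b r * d (a ∷ ys)) _ ⟩
      _ ∎
    alternatingSum-antisymmetric {r} {d} anti (w ∷ xs) {a} {b} {ys} = begin
      w r * d (xs ++ a ∷ b ∷ ys) + -1# * alternatingSum (λ zs → d (w ∷ zs)) r (xs ++ a ∷ b ∷ ys)
        ≈⟨ +-cong (*-congˡ (anti xs)) (*-congˡ (alternatingSum-antisymmetric {d = λ zs → d (w ∷ zs)} (λ zs → anti (w ∷ zs)) xs)) ⟩
      w r * (-1# * d (xs ++ b ∷ a ∷ ys)) + -1# * (-1# * alternatingSum (λ zs → d (w ∷ zs)) r (xs ++ b ∷ a ∷ ys))
        ≈⟨ solve 4 (λ m x y z → (x :* (m :* y) :+ m :* (m :* z)) := (m :* (x :* y :+ m :* z)))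
             ≈-refl -1# (w r) (d (xs ++ b ∷ a ∷ ys)) _ ⟩
      _ ∎

    -- The two terms that delete one of the equal neighbours cancel, and every other term still
    -- contains both.
    alternatingSum-alternating : ∀ {r d} → Alternating d → Alternating (alternatingSum d r)
    alternatingSum-alternating {r} {d} alt [] {a} {ys} = begin
      a r * d (a ∷ ys) + -1# * (a r * d (a ∷ ys) + -1# * alternatingSum (λ zs → d (a ∷ a ∷ zs)) r ys)
        ≈⟨ +-congˡ (*-congˡ (≈-trans (+-congˡ (≈-trans (*-congˡ (alternatingSum-zero (λ zs → alt []) r ys)) (zeroʳ _))) (+-identityʳ _))) ⟩
      a r * d (a ∷ ys) + -1# * (a r * d (a ∷ ys))
        ≈⟨ +-congˡ (-1*x≈-x _) ⟩
      a r * d (a ∷ ys) - a r * d (a ∷ ys)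
        ≈⟨ -‿inverseʳ _ ⟩
      0# ∎
    alternatingSum-alternating {r} {d} alt (w ∷ xs) {a} {ys} = begin
      w r * d (xs ++ a ∷ a ∷ ys) + -1# * alternatingSum (λ zs → d (w ∷ zs)) r (xs ++ a ∷ a ∷ ys)
        ≈⟨ +-cong (*-congˡ (alt xs)) (*-congˡ (alternatingSum-alternating {d = λ zs → d (w ∷ zs)} (λ zs → alt (w ∷ zs)) xs)) ⟩
      w r * 0# + -1# * 0#
        ≈⟨ α0+β0≈0 _ _ ⟩
      0# ∎

    columnDet-linear : ∀ rs → Linear rs (columnDet rs)
    columnDet-linear [] []       α β _ = ≈-sym (α0+β0≈0 α β)
    columnDet-linear [] (_ ∷ _)  α β _ = ≈-sym (α0+β0≈0 α β)
    columnDet-linear (r ∷ rs)          = alternatingSum-linear (columnDet-linear rs)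

    columnDet-antisymmetric : ∀ rs → Antisymmetric (columnDet rs)
    columnDet-antisymmetric [] []      = ≈-sym (zeroʳ _)
    columnDet-antisymmetric [] (_ ∷ _) = ≈-sym (zeroʳ _)
    columnDet-antisymmetric (r ∷ rs)   = alternatingSum-antisymmetric (columnDet-antisymmetric rs)

    columnDet-alternating : ∀ rs → Alternating (columnDet rs)
    columnDet-alternating [] []      = ≈-refl
    columnDet-alternating [] (_ ∷ _) = ≈-refl
    columnDet-alternating (r ∷ rs)   = alternatingSum-alternating (columnDet-alternating rs)

  -- Agreement with the determinant of the statement.

  module _ {I : Set} (A : I → I → Carrier) where

    columnOf : I → Column
    columnOf u v = A v u

    -- `expand` is private to Defs. Unification fills in the body of `laplace` when `det-laplace` is
    -- checked: there all four arguments of `expand` have been abstracted to variables.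
    mutual
      laplace : (List I → Carrier) → (I → Carrier) → Carrier → List I → List I → Carrier
      laplace = _

      det-laplace : ∀ r rs cs → det F A (r ∷ rs) cs ≡ laplace (det F A rs) (A r) 1# [] cs
      det-laplace r rs cs with det F A rs | A r | 1# | List.[] {A = I}
      ... | d | row | s | pre = ≡.refl

    -- The accumulated sign `s` comes out as a factor, and the accumulated prefix is absorbed: `d′`
    -- is `d` with the columns of `pre` already supplied.
    laplace≈alternatingSum : ∀ {d d′ r} s pre cs → (∀ us → d (pre ++ us) ≈ d′ (map columnOf us)) →
      laplace d (A r) s pre cs ≈ s * alternatingSum d′ r (map columnOf cs)
    laplace≈alternatingSum s pre [] d≈ = ≈-sym (zeroʳ s)
    laplace≈alternatingSum {d} {d′} {r} s pre (c ∷ cs) d≈ = begin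
      s * (A r c * d (pre ++ cs)) + laplace d (A r) (- s) (pre ++ (c ∷ [])) cs
        ≈⟨ +-cong (*-congˡ (*-congˡ (d≈ cs)))
             (laplace≈alternatingSum {d′ = λ ys → d′ (columnOf c ∷ ys)} (- s) (pre ++ (c ∷ [])) cs
               (λ us → ≈-trans (reflexive (≡.cong d (++-assoc pre (c ∷ []) us))) (d≈ (c ∷ us)))) ⟩
      s * (A r c * d′ (map columnOf cs)) + - s * alternatingSum (λ ys → d′ (columnOf c ∷ ys)) r (map columnOf cs)
        ≈⟨ +-congˡ (*-congʳ (≈-sym (-1*x≈-x s))) ⟩
      s * (A r c * d′ (map columnOf cs)) + -1# * s * alternatingSum (λ ys → d′ (columnOf c ∷ ys)) r (map columnOf cs)
        ≈⟨ solve 4 (λ m s x y → (s :* x :+ m :* s :* y) := (s :* (x :+ m :* y))) ≈-refl -1# s _ _ ⟩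
      _ ∎

    det≈columnDet : ∀ rs cs → det F A rs cs ≈ columnDet rs (map columnOf cs)
    det≈columnDet []       []       = ≈-refl
    det≈columnDet []       (_ ∷ _)  = ≈-refl
    det≈columnDet (r ∷ rs) cs = begin
      det F A (r ∷ rs) cs
        ≈⟨ reflexive (det-laplace r rs cs) ⟩
      laplace (det F A rs) (A r) 1# [] cs
        ≈⟨ laplace≈alternatingSum 1# [] cs (det≈columnDet rs) ⟩
      1# * alternatingSum (columnDet rs) r (map columnOf cs)
        ≈⟨ *-identityˡ _ ⟩
      _ ∎

  -- Vanishing determinants and spans of columns.

  module _ {R : Set} where

    -- Only vanishing is transported, so the sign of the permutation need not be tracked. The prefix
    -- `pre` collects the common heads of the two lists.
    vanishes-resp-↭ : ∀ rs {xs ys : List (Column)} → xs ↭ ys → ∀ pre →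
      columnDet rs (pre ++ xs) ≈ 0# → columnDet {R} rs (pre ++ ys) ≈ 0#
    vanishes-resp-↭ rs refl pre d≈0 = d≈0
    vanishes-resp-↭ rs {x ∷ xs} {_ ∷ ys} (prep x xs↭ys) pre d≈0 =
      ≡.subst (λ zs → columnDet rs zs ≈ 0#) (++-assoc pre (x ∷ []) ys)
        (vanishes-resp-↭ rs xs↭ys (pre ++ x ∷ [])
          (≡.subst (λ zs → columnDet rs zs ≈ 0#) (≡.sym (++-assoc pre (x ∷ []) xs)) d≈0))
    vanishes-resp-↭ rs {_ ∷ _ ∷ xs} {_ ∷ _ ∷ ys} (swap x y xs↭ys) pre d≈0 =
      ≡.subst (λ zs → columnDet rs zs ≈ 0#) (++-assoc pre (y ∷ x ∷ []) ys)
        (vanishes-resp-↭ rs xs↭ys (pre ++ y ∷ x ∷ [])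
          (≡.subst (λ zs → columnDet rs zs ≈ 0#) (≡.sym (++-assoc pre (y ∷ x ∷ []) xs))
            (≈-trans (columnDet-antisymmetric rs pre) (≈-trans (*-congˡ d≈0) (zeroʳ _)))))
    vanishes-resp-↭ rs (trans xs↭ys ys↭zs) pre d≈0 =
      vanishes-resp-↭ rs ys↭zs pre (vanishes-resp-↭ rs xs↭ys pre d≈0)

    module _ {J : Set} (_≟_ : DecidableEquality J) (col : J → Column {R}) where
      open DecMembership _≟_ using (_∈?_)

      -- Either us repeats an index or it is a permutation of cs.
      vanishes-⊆ : ∀ rs cs us pre → us ⊆ cs → length cs ≤ length us →
        (length us ≡ length cs → columnDet rs (pre ++ map col cs) ≈ 0#) →
        columnDet rs (pre ++ map col us) ≈ 0#
      vanishes-⊆ rs [] []      pre us⊆ _  d≈0 = d≈0 ≡.refl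
      vanishes-⊆ rs [] (_ ∷ _) pre us⊆ _  d≈0 with us⊆ (here ≡.refl)
      ... | ()
      vanishes-⊆ rs (c ∷ cs) us pre us⊆ ≤us d≈0 with c ∈? us
      -- Now `us` has more entries than the remaining `cs`, so the case of equal lengths is void
      -- from here on and a repetition must turn up.
      ... | no c∉us =
        vanishes-⊆ rs cs us pre (⊆-tail us⊆ c∉us) (ℕₚ.<⇒≤ ≤us) (λ eq → ⊥-elim (ℕₚ.<⇒≢ ≤us (≡.sym eq)))
      ... | yes c∈us with ∈⇒↭∷ c∈us
      ... | vs , us↭c∷vs = vanishes-resp-↭ rs (↭-sym (map⁺ col us↭c∷vs)) pre d-c∷vs≈0
        where
        d-c∷vs≈0 : columnDet rs (pre ++ col c ∷ map col vs) ≈ 0#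
        d-c∷vs≈0 with c ∈? vs
        -- A second occurrence of `c`: moved to the front, the two copies are adjacent equal
        -- columns.
        ... | yes c∈vs with ∈⇒↭∷ c∈vs
        ...   | ws , vs↭c∷ws =
          vanishes-resp-↭ rs (↭-sym (map⁺ col (prep c vs↭c∷ws))) pre (columnDet-alternating rs pre)
        d-c∷vs≈0 | no c∉vs =
          ≡.subst (λ zs → columnDet rs zs ≈ 0#) (++-assoc pre (col c ∷ []) (map col vs))
            (vanishes-⊆ rs cs vs (pre ++ col c ∷ [])
              (⊆-tail (λ v∈vs → us⊆ (∈-resp-↭ (↭-sym us↭c∷vs) (there v∈vs))) c∉vs)
              (ℕₚ.≤-pred (≡.subst (suc (length cs) ≤_) (↭-length us↭c∷vs) ≤us))
              (λ eq → ≡.subst (λ zs → columnDet rs zs ≈ 0#) (≡.sym (++-assoc pre (col c ∷ []) (map col cs)))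
                (d≈0 (≡.trans (↭-length us↭c∷vs) (≡.cong suc eq)))))

    -- Spans are generated inductively so that multilinearity can be applied by recursion. Equations
    -- are required only on rows in `Q`, where the factor matrices are controlled.
    data Span {J : Set} (Q : R → Set) (col : J → Column {R}) (C : List J) : Column {R} → Set (c ⊔ ℓ) where
      generator   : ∀ {u} → u ∈ C → Span Q col C (col u)
      combination : ∀ {x y z} α β → Span Q col C x → Span Q col C y →
                    (∀ r → Q r → z r ≈ α * x r + β * y r) → Span Q col C z
      null        : ∀ {z} → (∀ r → Q r → z r ≈ 0#) → Span Q col C z

    module _ {J : Set} {Q : R → Set} {col : J → Column {R}} {C : List J} where

      Span-resp : ∀ {x y} → Span Q col C x → (∀ r → Q r → y r ≈ x r) → Span Q col C y
      Span-resp x y≈x = combination 1# 0# x x (λ r q → ≈-trans (y≈x r q) (≈-sym (≈-trans (x+0y≈x _ _) (*-identityˡ _))))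

      Span-Σ : ∀ {I : Set} (us : List I) (g : I → Carrier) (x : I → Column) → (∀ {u} → u ∈ us → Span Q col C (x u)) →
        Span Q col C (λ r → ΣL F us (λ u → g u * x u r))
      Span-Σ []       g x spans = null (λ _ _ → ≈-refl)
      Span-Σ (u ∷ us) g x spans =
        combination (g u) 1# (spans (here ≡.refl)) (Span-Σ us g x (λ u∈ → spans (there u∈)))
          (λ _ _ → +-congˡ (≈-sym (*-identityˡ _)))

      vanishes-on-Span : ∀ {rs} → All Q rs → ∀ xs {ys z} →
        (∀ {u} → u ∈ C → columnDet rs (xs ++ col u ∷ ys) ≈ 0#) →
        Span Q col C z → columnDet rs (xs ++ z ∷ ys) ≈ 0#
      vanishes-on-Span Qs xs d≈0 (generator u∈C) = d≈0 u∈C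
      vanishes-on-Span {rs} Qs xs d≈0 (combination {x} {y} α β sx sy z≈) =
        ≈-trans (columnDet-linear rs xs α β (All.map (λ {r} → z≈ r) Qs))
          (≈-trans (+-cong (*-congˡ (vanishes-on-Span Qs xs d≈0 sx)) (*-congˡ (vanishes-on-Span Qs xs d≈0 sy)))
            (α0+β0≈0 α β))
      -- A zero column is 0·z + 0·z, so linearity makes the determinant zero.
      vanishes-on-Span {rs} Qs xs {z = z} d≈0 (null z≈0) =
        ≈-trans (columnDet-linear rs xs {a = z} {b = z} 0# 0#
            (All.map (λ {r} q → ≈-trans (z≈0 r q) (≈-sym (≈-trans (x+0y≈x _ _) (zeroˡ _)))) Qs))
          (≈-trans (x+0y≈x _ _) (zeroˡ _))

      -- The columns `ts` are traded one at a time for generators, collected in `us`. In the end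
      -- only |C| generators remain: they contain a repetition or are a permutation of `C`, and the
      -- determinant vanishes either way.
      columnDet-spanned : DecidableEquality J → ∀ {rs} → All Q rs → columnDet rs (map col C) ≈ 0# →
        ∀ us ts → us ⊆ C → All (Span Q col C) ts → length us ℕ.+ length ts ≡ length C →
        columnDet rs (map col us ++ ts) ≈ 0#
      columnDet-spanned _≟_ {rs} Qs d≈0 us [] us⊆C [] eq =
        ≡.subst (λ zs → columnDet rs zs ≈ 0#) (≡.sym (++-identityʳ (map col us)))
          (vanishes-⊆ _≟_ col rs C us [] us⊆C (ℕₚ.≤-reflexive (≡.trans (≡.sym eq) (ℕₚ.+-identityʳ _))) (λ _ → d≈0))
      columnDet-spanned _≟_ {rs} Qs d≈0 us (t ∷ ts) us⊆C (st ∷ sts) eq =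
        vanishes-on-Span Qs (map col us) (λ {u} u∈C →
          ≡.subst (λ zs → columnDet rs zs ≈ 0#) (++-assoc-map u)
            (columnDet-spanned _≟_ Qs d≈0 (us ++ u ∷ []) ts (snoc-⊆ u∈C) sts (≡.trans (length-snoc u) eq))) st
        where
        ++-assoc-map : ∀ u → map col (us ++ u ∷ []) ++ ts ≡ map col us ++ col u ∷ ts
        ++-assoc-map u = ≡.trans (≡.cong (_++ ts) (map-++ col us (u ∷ []))) (++-assoc (map col us) (col u ∷ []) ts)
        length-snoc : ∀ u → length (us ++ u ∷ []) ℕ.+ length ts ≡ length us ℕ.+ suc (length ts)
        length-snoc u = ≡.trans (≡.cong (ℕ._+ length ts) (length-++-comm us (u ∷ []))) (≡.sym (ℕₚ.+-suc (length us) (length ts)))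
        snoc-⊆ : ∀ {u} → u ∈ C → us ++ u ∷ [] ⊆ C
        snoc-⊆ {u} u∈C {v} v∈ = All.lookup (Allₚ.++⁺ (All.tabulate us⊆C) (u∈C ∷ [])) v∈

    alternatingSum-zeroRow : ∀ d {r : R} {xs} → All (λ x → x r ≈ 0#) xs → alternatingSum d r xs ≈ 0#
    alternatingSum-zeroRow d []         = ≈-refl
    alternatingSum-zeroRow d (x≈0 ∷ xs≈0) =
      ≈-trans (+-cong (≈-trans (*-congʳ x≈0) (zeroˡ _))
                      (≈-trans (*-congˡ (alternatingSum-zeroRow _ xs≈0)) (zeroʳ _)))
        (+-identityʳ 0#)

    -- In the first row all entries after the first vanish, since `r` differs from the later
    -- indices; the remaining minor is handled by induction.
    columnDet-identity : (E : R → Column) → (∀ v → E v v ≈ 1#) → (∀ {v w} → v ≢ w → E w v ≈ 0#) →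
      ∀ {rs} → Unique rs → columnDet rs (map E rs) ≈ 1#
    columnDet-identity E diag off []          = ≈-refl
    columnDet-identity E diag off {r ∷ rs} (r≢ ∷ uniq) = begin
      E r r * columnDet rs (map E rs) + -1# * alternatingSum (λ ys → columnDet rs (E r ∷ ys)) r (map E rs)
        ≈⟨ +-cong (*-cong (diag r) (columnDet-identity E diag off uniq))
             (*-congˡ (alternatingSum-zeroRow _ (Allₚ.map⁺ (All.map off r≢)))) ⟩
      1# * 1# + -1# * 0#
        ≈⟨ +-cong (*-identityˡ 1#) (zeroʳ _) ⟩
      1# + 0#
        ≈⟨ +-identityʳ 1# ⟩
      1# ∎

  spanning⇒det≉0 : ∀ {I : Set} → DecidableEquality I → (A : I → I → Carrier) {Q : I → Set} →
    (E : I → Column) → (∀ v → E v v ≈ 1#) → (∀ {v w} → v ≢ w → E w v ≈ 0#) →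
    ∀ {rs C} → Unique rs → All Q rs → length C ≡ length rs →
    All (λ v → Span Q (columnOf A) C (E v)) rs → ¬ (det F A rs C ≈ 0#)
  spanning⇒det≉0 _≟_ A E diag off {rs} {C} uniq Qs len spans d≈0 = 1≉0 (begin
    1#
      ≈⟨ columnDet-identity E diag off uniq ⟨
    columnDet rs (map E rs)
      ≈⟨ columnDet-spanned _≟_ Qs (≈-trans (≈-sym (det≈columnDet A rs C)) d≈0)
           [] (map E rs) (λ ()) (Allₚ.map⁺ spans) (≡.trans (length-map E rs) (≡.sym len)) ⟩
    0# ∎)

  -- Finite sums, and transport of spans.

  ΣL-↭ : ∀ {I : Set} {us vs : List I} → us ↭ vs → ∀ f → ΣL F us f ≈ ΣL F vs f
  ΣL-↭ refl f = ≈-refl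
  ΣL-↭ (prep x p) f = +-congˡ (ΣL-↭ p f)
  ΣL-↭ (swap x y p) f = ≈-trans (≈-sym (+-assoc _ _ _)) (≈-trans (+-cong (+-comm _ _) (ΣL-↭ p f)) (+-assoc _ _ _))
  ΣL-↭ (trans p q) f = ≈-trans (ΣL-↭ p f) (ΣL-↭ q f)

  ΣL-cong : ∀ {I : Set} (us : List I) {f g} → (∀ {u} → u ∈ us → f u ≈ g u) → ΣL F us f ≈ ΣL F us g
  ΣL-cong []       f≈g = ≈-refl
  ΣL-cong (u ∷ us) f≈g = +-cong (f≈g (here ≡.refl)) (ΣL-cong us (λ u∈ → f≈g (there u∈)))

  ΣL-*ʳ : ∀ {I : Set} (us : List I) f a → ΣL F us f * a ≈ ΣL F us (λ u → f u * a)
  ΣL-*ʳ []       f a = zeroˡ a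
  ΣL-*ʳ (u ∷ us) f a = ≈-trans (distribʳ a _ _) (+-congˡ (ΣL-*ʳ us f a))

  -- Pulling back along `ρ` and weighting by `w` is a linear map, so it carries spans to spans. With
  -- `ρ` = `tail` and `w` a column of the first factor, it is tensoring with that column.
  Span-map : ∀ {R R′ J J′ : Set} {Q : R → Set} {Q′ : R′ → Set} {col : J → Column} {col′ : J′ → Column} {C D}
    (w : R′ → Carrier) (ρ : R′ → R) (φ : J → J′) → (∀ {r} → Q′ r → Q (ρ r)) →
    (∀ {u} → u ∈ C → φ u ∈ D) → (∀ u r → Q′ r → w r * col u (ρ r) ≈ col′ (φ u) r) →
    ∀ {x} → Span Q col C x → Span Q′ col′ D (λ r → w r * x (ρ r))
  Span-map w ρ φ Q⇒ C⇒ col≈ (generator u∈C) = Span-resp (generator (C⇒ u∈C)) (col≈ _)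
  Span-map w ρ φ Q⇒ C⇒ col≈ (combination {x} {y} {z} α β sx sy z≈) =
    combination α β (Span-map w ρ φ Q⇒ C⇒ col≈ sx) (Span-map w ρ φ Q⇒ C⇒ col≈ sy) λ r q → begin
      w r * z (ρ r)                               ≈⟨ *-congˡ (z≈ (ρ r) (Q⇒ q)) ⟩
      w r * (α * x (ρ r) + β * y (ρ r))           ≈⟨ distribˡ _ _ _ ⟩
      w r * (α * x (ρ r)) + w r * (β * y (ρ r))   ≈⟨ +-cong (x∙yz≈y∙xz _ _ _) (x∙yz≈y∙xz _ _ _) ⟩
      α * (w r * x (ρ r)) + β * (w r * y (ρ r))   ∎
  Span-map w ρ φ Q⇒ C⇒ col≈ (null z≈0) = null (λ r q → ≈-trans (*-congˡ (z≈0 (ρ r) (Q⇒ q))) (zeroʳ _))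

  Span-⊆ : ∀ {R J : Set} {Q : R → Set} {col : J → Column} {C D x} → C ⊆ D → Span Q col C x → Span Q col D x
  Span-⊆ C⊆D (generator u∈C)           = generator (C⊆D u∈C)
  Span-⊆ C⊆D (combination α β sx sy z≈) = combination α β (Span-⊆ C⊆D sx) (Span-⊆ C⊆D sy) z≈
  Span-⊆ C⊆D (null z≈0)                = null z≈0

  -- The induction over the tensor factors.

  module _ {X : Set} (Δ : X → X → Carrier) where

    -- A column of the identity matrix, written as a Kronecker power so that `unit (a ∷ w) (b ∷ v)`
    -- unfolds to `Δ b a * unit w v`.
    unit : ∀ {k} → Vec X k → Column {Vec X k}
    unit {k} = columnOf (kron F k (λ _ → Δ))

    unit-diagonal : (∀ a → Δ a a ≈ 1#) → ∀ {k} (v : Vec X k) → unit v v ≈ 1#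
    unit-diagonal Δ-diag []      = ≈-refl
    unit-diagonal Δ-diag (a ∷ v) = ≈-trans (*-cong (Δ-diag a) (unit-diagonal Δ-diag v)) (*-identityˡ 1#)

    unit-offDiagonal : DecidableEquality X → (∀ {a b} → a ≢ b → Δ a b ≈ 0#) → ∀ {k} {v w : Vec X k} → v ≢ w → unit w v ≈ 0#
    unit-offDiagonal _≟_ Δ-off {v = []} {[]} v≢w = ⊥-elim (v≢w ≡.refl)
    unit-offDiagonal _≟_ Δ-off {v = a ∷ v} {b ∷ w} v≢w with a ≟ b
    ... | yes ≡.refl = ≈-trans (*-congˡ (unit-offDiagonal _≟_ Δ-off (λ v≡w → v≢w (≡.cong (a ∷_) v≡w)))) (zeroʳ _)
    ... | no a≢b     = ≈-trans (*-congʳ (Δ-off a≢b)) (zeroˡ _)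

    -- The properties of one T'_i that the induction uses: `A` is the inverse of T_i, `R` the
    -- nonzero part of `S`, and `section` is T_i itself.
    record Factor (A : X → X → Carrier) (S R : List X) : Set (c ⊔ ℓ) where
      field
        unique    : Unique S
        size      : length S ≡ suc (length R)
        rowSum    : ∀ {v} → v ∈ R → ΣL F S (A v) ≈ 0#
        section   : X → X → Carrier
        isSection : ∀ {v w} → v ∈ R → w ∈ R → ΣL F S (λ u → A v u * section u w) ≈ Δ v w

    -- The induction hypothesis is that the unit vectors are spanned, because spans can be assembled
    -- slice by slice; the determinant enters only at the end.
    record SpanningSet {k} (A : Fin k → X → X → Carrier) (S R : Fin k → List X) (M : List (Vec X k)) : Set (c ⊔ ℓ) where
      field
        columns  : List (Vec X k)
        unique   : Unique columns
        unmarked : All (λ t → InProduct S t × t ∉ M) columns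
        size     : length columns ≡ length (prodList k R)
        spans    : ∀ w → InProduct R w → Span (InProduct R) (columnOf (kron F k A)) columns (unit w)

    module _ (_≟_ : DecidableEquality X) {k} {A : Fin (suc k) → X → X → Carrier} {S R : Fin (suc k) → List X} {M : List (Vec X (suc k))} where

      private
        A₊ : Fin k → X → X → Carrier
        A₊ i = A (suc i)
        S₊ R₊ : Fin k → List X
        S₊ i = S (suc i)
        R₊ i = R (suc i)

      -- The tensor product of column `u` of the first factor with a unit vector of the remaining
      -- ones.
      slab : X → Vec X k → Column
      slab u w v = A zero (head v) u * unit w (tail v)

      -- The intermediate stage, in which only the first coordinates in `us` have been treated; each
      -- contributes as many columns as the remaining factors have rows.
      record Blocks (us : List X) : Set (c ⊔ ℓ) where
        field
          columns  : List (Vec X (suc k))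
          unique   : Unique columns
          heads    : All (λ t → head t ∈ us) columns
          unmarked : All (λ t → InProduct S₊ (tail t) × t ∉ M) columns
          size     : length columns ≡ length us ℕ.* length (prodList k R₊)
          spans    : ∀ {u} → u ∈ us → ∀ w → InProduct R₊ w →
                     Span (InProduct R) (columnOf (kron F (suc k) A)) columns (slab u w)

      blocks : ∀ {us} → Unique us → All (λ u → SpanningSet A₊ S₊ R₊ (slice _≟_ u M)) us → Blocks us
      blocks [] [] = record
        { columns = [] ; unique = [] ; heads = [] ; unmarked = [] ; size = ≡.refl ; spans = λ () }
      blocks {u ∷ us} (u≢us ∷ uniq) (block ∷ rest) = record
        { columns  = C
        ; unique   = Uniqueₚ.++⁺ (Uniqueₚ.map⁺ ∷-injectiveʳ block.unique) rest.unique disjoint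
        ; heads    = Allₚ.++⁺ (Allₚ.map⁺ (All.tabulate (λ _ → here ≡.refl))) (All.map there rest.heads)
        ; unmarked = Allₚ.++⁺ (Allₚ.map⁺ (All.map (λ (t∈S , t∉) → t∈S , λ ut∈M → t∉ (∈-slice⁺ _≟_ ut∈M)) block.unmarked)) rest.unmarked
        ; size     = ≡.trans (length-++ Cᵤ) (≡.cong₂ ℕ._+_ (≡.trans (length-map (u ∷_) block.columns) block.size) rest.size)
        ; spans    = spans
        }
        where
        module block = SpanningSet block
        module rest = Blocks (blocks uniq rest)
        Cᵤ C : List (Vec X (suc k))
        Cᵤ = map (u ∷_) block.columns
        C  = Cᵤ ++ rest.columns
        disjoint : ∀ {t} → ¬ (t ∈ Cᵤ × t ∈ rest.columns)
        disjoint (t∈Cᵤ , t∈rest) with ∈-map⁻ (u ∷_) t∈Cᵤ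
        ... | _ , _ , ≡.refl = All.lookup u≢us (All.lookup rest.heads t∈rest) ≡.refl
        spans : ∀ {u′} → u′ ∈ u ∷ us → ∀ w → InProduct R₊ w →
                Span (InProduct R) (columnOf (kron F (suc k) A)) C (slab u′ w)
        spans (here ≡.refl) w w∈ =
          -- The span obtained for the slice at `u` is tensored with column `u` of the first factor.
          Span-map (λ v → A zero (head v) u) tail (u ∷_) (λ { {_ ∷ _} v∈ i → v∈ (suc i) })
            (λ t∈ → xs⊆xs++ys Cᵤ _ (∈-map⁺ (u ∷_) t∈)) (λ { _ (_ ∷ _) _ → ≈-refl }) (block.spans w w∈)
        spans (there u′∈us) w w∈ = Span-⊆ (xs⊆ys++xs _ Cᵤ) (rest.spans u′∈us w w∈)

      extend : Factor (A zero) (S zero) (R zero) → ∀ {u₀ us} → S zero ↭ u₀ ∷ us →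
               All (λ u → SpanningSet A₊ S₊ R₊ (slice _≟_ u M)) us → SpanningSet A S R M
      extend factor {u₀} {us} S↭ bs with Unique-resp-↭ S↭ (Factor.unique factor)
      ... | _ ∷ uniq = record
        { columns  = B.columns
        ; unique   = B.unique
        ; unmarked = All.zipWith (λ { {_ ∷ _} (h , t∈ , t∉M) → (λ { zero → us⊆S h ; (suc i) → t∈ i }) , t∉M }) (B.heads , B.unmarked)
        ; size     = ≡.trans B.size (≡.trans (≡.cong (ℕ._* length (prodList k R₊)) length-us) (≡.sym (length-prodList k R)))
        -- Column `a` of `section` writes the unit vector at `a` as a combination of the columns of
        -- the first factor; tensored with `unit w`, this is a combination of slabs.
        ; spans    = λ { (a ∷ w) w∈ → Span-resp (Span-Σ (S zero) (λ u → section u a) (λ u → slab u w) (λ u∈ → span-slab u∈ w (λ i → w∈ (suc i))))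
                        (λ { (b ∷ v) v∈ → unit≈ w b v (v∈ zero) (w∈ zero) }) }
        }
        where
        open Factor factor
        module B = Blocks (blocks uniq bs)
        us⊆S : us ⊆ S zero
        us⊆S u∈us = ∈-resp-↭ (↭-sym S↭) (there u∈us)
        length-us : length us ≡ length (R zero)
        length-us = ℕₚ.suc-injective (≡.trans (≡.sym (↭-length S↭)) size)
        unit≈ : ∀ {a} w b v → b ∈ R zero → a ∈ R zero →
          Δ b a * unit w v ≈ ΣL F (S zero) (λ u → section u a * (A zero b u * unit w v))
        unit≈ {a} w b v b∈ a∈ = begin
          Δ b a * unit w v                                              ≈⟨ *-congʳ (isSection b∈ a∈) ⟨
          ΣL F (S zero) (λ u → A zero b u * section u a) * unit w v     ≈⟨ ΣL-*ʳ (S zero) _ _ ⟩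
          ΣL F (S zero) (λ u → A zero b u * section u a * unit w v)
            ≈⟨ ΣL-cong (S zero) (λ _ → ≈-trans (*-congʳ (*-comm _ _)) (*-assoc _ _ _)) ⟩
          ΣL F (S zero) (λ u → section u a * (A zero b u * unit w v))   ∎
        span-slab : ∀ {u} → u ∈ S zero → ∀ w → InProduct R₊ w →
          Span (InProduct R) (columnOf (kron F (suc k) A)) B.columns (slab u w)
        span-slab u∈ w w∈ with ∈-resp-↭ S↭ u∈
        ... | there u∈us = B.spans u∈us w w∈
        -- For the omitted coordinate, `rowSum` makes the slab at `u₀` minus the sum of the slabs
        -- over `us`.
        span-slab u∈ w w∈ | here ≡.refl =
          Span-resp (Span-Σ us (λ _ → -1#) (λ u → slab u w) (λ u∈us → B.spans u∈us w w∈))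
            (λ { (b ∷ v) v∈ → slab-u₀ b v (v∈ zero) })
          where
          slab-u₀ : ∀ b v → b ∈ R zero →
            A zero b u₀ * unit w v ≈ ΣL F us (λ u → -1# * (A zero b u * unit w v))
          slab-u₀ b v b∈ = begin
            A zero b u₀ * unit w v
              ≈⟨ *-congʳ (+-inverseˡ-unique _ _ (≈-trans (≈-sym (ΣL-↭ S↭ (A zero b))) (rowSum b∈))) ⟩
            - ΣL F us (A zero b) * unit w v
              ≈⟨ *-congʳ (-1*x≈-x _) ⟨
            -1# * ΣL F us (A zero b) * unit w v
              ≈⟨ *-congʳ (≈-trans (*-comm _ _) (≈-trans (ΣL-*ʳ us _ _) (ΣL-cong us (λ _ → *-comm _ _)))) ⟩
            ΣL F us (λ u → -1# * A zero b u) * unit w v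
              ≈⟨ ΣL-*ʳ us _ _ ⟩
            ΣL F us (λ u → -1# * A zero b u * unit w v)
              ≈⟨ ΣL-cong us (λ _ → *-assoc _ _ _) ⟩
            ΣL F us (λ u → -1# * (A zero b u * unit w v)) ∎

    spanningSet : DecidableEquality X → ∀ k {A : Fin k → X → X → Carrier} {S R : Fin k → List X} →
      (∀ i → Factor (A i) (S i) (R i)) → ∀ M → length M < 2 ℕ.^ k → SpanningSet A S R M
    -- The empty product has a single column, which is unmarked because fewer than 2^0 = 1 marks are
    -- left.
    spanningSet _≟_ zero factors [] _ = record
      { columns  = [] ∷ []
      ; unique   = [] ∷ []
      ; unmarked = ((λ ()) , (λ ())) ∷ []
      ; size     = ≡.refl
      ; spans    = λ { [] _ → generator (here ≡.refl) }
      }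
    spanningSet _≟_ zero factors (_ ∷ _) (s≤s ())
    spanningSet _≟_ (suc k) {S = S} factors M M<2^k
      -- A slice is too heavy for the recursion if it has at least 2^k marks; two such slices would
      -- exceed the bound of fewer than 2·2^k marks in all.
      with setAside (λ u → 2 ℕ.^ k ℕ.≤? length (slice _≟_ u M)) (Factor.unique (factors zero))
             (≡.subst (0 <_) (≡.sym (Factor.size (factors zero))) (s≤s z≤n))
             (slices-not-both-large _≟_ M M<2^k)
    ... | u₀ , us , S↭ , small =
      extend _≟_ (factors zero) S↭ (All.map (λ {u} u≱ → spanningSet _≟_ k (λ i → factors (suc i)) (slice _≟_ u M) (ℕₚ.≰⇒> u≱)) small)

  -- The binomial matrices as tensor factors.

  module _ {n : ℕ} where
    private
      _≟_ : DecidableEquality (Vec ℕ n)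
      _≟_ = ≡-dec ℕ._≟_

    δ-diagonal : ∀ (v : Vec ℕ n) → δ F v v ≈ 1#
    δ-diagonal v with v ≟ v
    ... | yes _  = ≈-refl
    ... | no v≢v = ⊥-elim (v≢v ≡.refl)

    δ-offDiagonal : ∀ {v w : Vec ℕ n} → v ≢ w → δ F v w ≈ 0#
    δ-offDiagonal {v} {w} v≢w with v ≟ w
    ... | yes v≡w = ⊥-elim (v≢w v≡w)
    ... | no _    = ≈-refl

    Tmat-zero : ∀ (v : Vec ℕ n) → Tmat F v (replicate n 0) ≈ 1#
    Tmat-zero v = ≈-trans (reflexive (≡.cong (ℕ→F F) (binomVec-zero v))) (+-identityʳ 1#)

    star-factor : ∀ {S} (Tinv : Vec ℕ n → Vec ℕ n → Carrier) → Unique S → DownClosed S → (∃ λ e → e ∈ S × e ≢ replicate n 0) →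
      (∀ v w → v ∈ S → w ∈ S → ΣL F S (λ u → Tinv v u * Tmat F u w) ≈ δ F v w) →
      Factor (δ F) Tinv S (star S)
    star-factor {S} Tinv uniq down (e , e∈S , _) Tinv*T≈δ = record
      { unique    = uniq
      ; size      = ≡.sym (length-filter-≢ _≟_ uniq 0∈S)
      ; rowSum    = rowSum
      ; section   = Tmat F
      ; isSection = λ v∈ w∈ → Tinv*T≈δ _ _ (proj₁ (∈-filter⁻ _ v∈)) (proj₁ (∈-filter⁻ _ w∈))
      }
      where
      0∈S : replicate n 0 ∈ S
      0∈S = down e e∈S (replicate n 0) (0≤ e)
      rowSum : ∀ {v} → v ∈ star S → ΣL F S (Tinv v) ≈ 0#
      rowSum {v} v∈ with ∈-filter⁻ (λ e → ¬? (e ≟ replicate n 0)) {xs = S} v∈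
      ... | v∈S , v≢0 = begin
        ΣL F S (Tinv v)
          -- Each summand is multiplied by the entry of T in column 0, which is 1, so that the row
          -- sum becomes an entry of the product of the inverse with T.
          ≈⟨ ΣL-cong S (λ {u} _ → ≈-trans (≈-sym (*-identityʳ _)) (*-congˡ (≈-sym (Tmat-zero u)))) ⟩
        ΣL F S (λ u → Tinv v u * Tmat F u (replicate n 0))
          ≈⟨ Tinv*T≈δ v (replicate n 0) v∈S 0∈S ⟩
        δ F v (replicate n 0)
          ≈⟨ δ-offDiagonal v≢0 ⟩
        0# ∎

-- Nonsingular submatrices that avoid the marked columns.

theorem3p5 : ∀ {c ℓ} (F : Field c ℓ) (n κ : ℕ) → 0 < κ →
    (S : Fin (ellOf κ) → List (Vec ℕ n)) →
    (∀ i → Unique (S i)) →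
    (∀ i → DownClosed (S i)) →
    (∀ i → ∃ λ e → e ∈ S i × e ≢ replicate n 0) →
    (Tinv : Fin (ellOf κ) → Vec ℕ n → Vec ℕ n → Field.Carrier F) →
    (∀ i v w → v ∈ S i → w ∈ S i →
    Field._≈_ F (ΣL F (S i) (λ u → Field._*_ F (Tinv i v u) (Tmat F u w))) (δ F v w)) →
    (∀ i v w → v ∈ S i → w ∈ S i →
    Field._≈_ F (ΣL F (S i) (λ u → Field._*_ F (Tmat F v u) (Tinv i u w))) (δ F v w)) →
    (M : List (Vec (Vec ℕ n) (ellOf κ))) → Unique M → length M ≡ κ → All (InProd S) M →
    ∃ λ (C : List (Vec (Vec ℕ n) (ellOf κ))) →
    Unique C × All (λ t → InProd S t × t ∉ M) C ×
    length C ≡ length (prodList (ellOf κ) (λ i → star (S i))) ×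
    ¬ (Field._≈_ F (det F (kron F (ellOf κ) Tinv) (prodList (ellOf κ) (λ i → star (S i))) C) (Field.0# F))
theorem3p5 F n κ _ S unique down nontrivial Tinv Tinv*T≈δ _ M _ |M|≡κ _ =
  C.columns , C.unique , C.unmarked , C.size ,
  spanning⇒det≉0 F (≡-dec (≡-dec ℕ._≟_)) (kron F k Tinv) (unit F (δ F))
    (unit-diagonal F (δ F) (δ-diagonal F)) (unit-offDiagonal F (δ F) (≡-dec ℕ._≟_) (δ-offDiagonal F))
    (prodList-unique k _ (λ i → Uniqueₚ.filter⁺ _ (unique i)))
    (All.tabulate (∈-prodList⁻ k _))
    C.size
    (All.tabulate (λ {v} v∈ → C.spans v (∈-prodList⁻ k _ v∈)))
  where
  k : ℕ
  k = ellOf κ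
  module C = SpanningSet (spanningSet F (δ F) (≡-dec ℕ._≟_) k
    (λ i → star-factor F (Tinv i) (unique i) (down i) (nontrivial i) (Tinv*T≈δ i))
    M (≡.subst (_< 2 ℕ.^ k) (≡.sym |M|≡κ) (κ<2^ellOf κ)))
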